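{- There exists an infinite family $\{G_i\}_{i\in\mathbb N}$ of (pairwise non-isomorphic) finite simple undirected graphs such that for every $i$, $\kappa_Q(G_i)\le 0.811\, n_i$, where $n_i$ is the order (number of vertices) of $G_i$.
   Context: Graphs are finite, nonempty, simple and undirected. For a graph $G=(V,E)$ and $C\subseteq V$, let $Odd(C)=\{v\in V : |N(v)\cap C|\equiv 1 \pmod 2\}$, where $N(v)$ is the open neighborhood of $v$. A set $B\subseteq V$ is a weak odd dominated (WOD) set if there exists $C\subseteq V\setminus B$ with $B\subseteq Odd(C)$. Let $\kappa(G)$ be the maximum size of a WOD set of $G$ and $\kappa'(G)$ the minimum size of a subset of $V$ that is not a WOD set. With $n=|V|$, $\kappa_Q(G)=\max(\kappa(G),\,n-\kappa'(G))$. -}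

module Defs where

open import Data.Bool using (Bool; true; false)
open import Data.Fin using (Fin; fromℕ<)
open import Data.Fin.Subset using (Subset; inside; outside; _∩_; ∁; ∣_∣; _⊆_; ⊤; ⊥)
open import Data.Fin.Subset.Properties
  using (anySubset?; _⊆?_; ∣p∣≤n; ∣⊤∣≡n; ∣⊥∣≡0; ⊥⊆; ∈⊤; ∩-zeroʳ; Empty-unique; x∈∁p⇒x∉p)
open import Data.List using (List; [_]; _++_; map; filter)
open import Data.List.Extrema.Nat using (max; min; xs≤max; min≤xs; argmax-sel; argmin-sel)
open import Data.List.Membership.Propositional using (_∈_)
open import Data.List.Membership.Propositional.Properties
  using (∈-++⁺ˡ; ∈-++⁺ʳ; ∈-map⁺; ∈-map⁻; ∈-filter⁺; ∈-filter⁻)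
open import Data.List.Relation.Unary.Any using (here)
import Data.List.Relation.Unary.All as All
open import Data.Nat using (ℕ; zero; suc; _⊔_; _∸_; _≤_; _%_; _≡ᵇ_; NonZero; >-nonZero⁻¹)
open import Data.Product using (∃; _×_; _,_; proj₂)
open import Data.Sum using (inj₁; inj₂)
import Data.Vec as Vec
import Data.Vec.Properties as Vec
open import Function using (id; _∘_; _↔_; Inverse)
open import Relation.Binary.PropositionalEquality using (_≡_; refl; sym; trans; cong)
open import Relation.Nullary using (¬_; ¬?; contradiction; _×-dec_)
open import Relation.Unary using (Decidable)

record Graph : Set where
  field
    order         : ℕ
    ⦃ nonempty ⦄  : NonZero order
    adjacent      : Fin order → Fin order → Bool
    symmetric     : ∀ u v → adjacent u v ≡ adjacent v u
    loopless      : ∀ v → adjacent v v ≡ false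

open Graph public using (order)

record _≅_ (G H : Graph) : Set where
  open Graph
  field
    bijection : Fin (order G) ↔ Fin (order H)
    preserves : ∀ u v →
      adjacent G u v ≡ adjacent H (Inverse.to bijection u) (Inverse.to bijection v)

subsets : ∀ n → List (Subset n)
subsets zero    = [ Vec.[] ]
subsets (suc n) = map (outside Vec.∷_) (subsets n) ++ map (inside Vec.∷_) (subsets n)

∈-subsets : ∀ {n} (p : Subset n) → p ∈ subsets n
∈-subsets Vec.[]           = here refl
∈-subsets (outside Vec.∷ p) = ∈-++⁺ˡ (∈-map⁺ _ (∈-subsets p))
∈-subsets (inside Vec.∷ p)  = ∈-++⁺ʳ _ (∈-map⁺ _ (∈-subsets p))

module _ (G : Graph) where
  open Graph G using (adjacent)

  N : Fin (order G) → Subset (order G)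
  N v = Vec.tabulate (adjacent v)

  Odd : Subset (order G) → Subset (order G)
  Odd C = Vec.tabulate λ v → ∣ N v ∩ C ∣ % 2 ≡ᵇ 1

  WOD : Subset (order G) → Set
  WOD B = ∃ λ C → C ⊆ ∁ B × B ⊆ Odd C

  WOD? : Decidable WOD
  WOD? B = anySubset? λ C → (C ⊆? ∁ B) ×-dec (B ⊆? Odd C)

  -- The default values 0 and order G are themselves attained, by ⊥ and ⊤
  -- respectively; see κ-attained and κ′-attained.
  κ : ℕ
  κ = max 0 (map ∣_∣ (filter WOD? (subsets (order G))))

  κ′ : ℕ
  κ′ = min (order G) (map ∣_∣ (filter (¬? ∘ WOD?) (subsets (order G))))

  κQ : ℕ
  κQ = κ ⊔ (order G ∸ κ′)

  WOD-⊥ : WOD ⊥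
  WOD-⊥ = ⊥ , ⊥⊆ , ⊥⊆

  ¬WOD-⊤ : ¬ WOD ⊤
  ¬WOD-⊤ (C , C⊆∁⊤ , ⊤⊆OddC) =
    contradiction (trans (sym v∈Odd) v∉Odd) λ ()
    where
    v : Fin (order G)
    v = fromℕ< (>-nonZero⁻¹ (order G))

    C≡⊥ : C ≡ ⊥
    C≡⊥ = Empty-unique λ (_ , x∈C) → x∈∁p⇒x∉p (C⊆∁⊤ x∈C) ∈⊤

    ∣N∩C∣≡0 : ∣ N v ∩ C ∣ ≡ 0
    ∣N∩C∣≡0 = trans (cong ∣_∣ (trans (cong (N v ∩_) C≡⊥) (∩-zeroʳ (N v)))) (∣⊥∣≡0 (order G))

    v∈Odd : Vec.lookup (Odd C) v ≡ true
    v∈Odd = Vec.[]=⇒lookup (⊤⊆OddC ∈⊤)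

    v∉Odd : Vec.lookup (Odd C) v ≡ false
    v∉Odd = trans (Vec.lookup∘tabulate _ v) (cong (λ k → k % 2 ≡ᵇ 1) ∣N∩C∣≡0)

  κ-attained : ∃ λ B → WOD B × ∣ B ∣ ≡ κ
  κ-attained with argmax-sel id 0 (map ∣_∣ (filter WOD? (subsets (order G))))
  ... | inj₁ κ≡0 = ⊥ , WOD-⊥ , trans (∣⊥∣≡0 (order G)) (sym κ≡0)
  ... | inj₂ κ∈  with B , B∈ , κ≡ ← ∈-map⁻ ∣_∣ κ∈ =
    B , proj₂ (∈-filter⁻ WOD? {xs = subsets (order G)} B∈) , sym κ≡

  κ-upper : ∀ B → WOD B → ∣ B ∣ ≤ κ
  κ-upper B wod =
    All.lookup (xs≤max 0 _) (∈-map⁺ ∣_∣ (∈-filter⁺ WOD? (∈-subsets B) wod))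

  κ′-attained : ∃ λ B → ¬ WOD B × ∣ B ∣ ≡ κ′
  κ′-attained with argmin-sel id (order G) (map ∣_∣ (filter (¬? ∘ WOD?) (subsets (order G))))
  ... | inj₁ κ′≡n = ⊤ , ¬WOD-⊤ , trans (∣⊤∣≡n (order G)) (sym κ′≡n)
  ... | inj₂ κ′∈  with B , B∈ , κ′≡ ← ∈-map⁻ ∣_∣ κ′∈ =
    B , proj₂ (∈-filter⁻ (¬? ∘ WOD?) {xs = subsets (order G)} B∈) , sym κ′≡

  κ′-lower : ∀ B → ¬ WOD B → κ′ ≤ ∣ B ∣
  κ′-lower B ¬wod =
    All.lookup (min≤xs (order G) _) (∈-map⁺ ∣_∣ (∈-filter⁺ (¬? ∘ WOD?) (∈-subsets B) ¬wod))

{-# OPTIONS --safe #-}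
module Submission where

-- By the Fredholm alternative over 𝔽₂, a set B that is not WOD contains a nonempty D with
-- Odd(D) ⊆ B. So κ and n − κ′ are both at most c once, for every nonempty C and each parity,
-- at most c vertices outside C have that parity of neighbours in C. Weigh C by
-- ∏ᵥ (a if v ∈ C or v has the wrong parity, else b). Outside C the parities of a random graph
-- are independent fair bits, so the expected sum of these weights is at most
-- ((3a + b) / 2)ⁿ, for each parity. In a graph not exceeding the total, a violation would need
-- bᶜ aⁿ⁻ᶜ ≤ 2 ((3a + b) / 2)ⁿ, which fails for c = 0.811 n, a = 63 and b = 811.

open import Defs
open import Algebra using (CommutativeRing)
open import Data.Bool using (Bool; true; false; not; _∧_; _xor_; if_then_else_)
open import Data.Bool.Properties
  using (∧-assoc; ∧-comm; ∧-zeroʳ; ∧-identityʳ; ∧-distribˡ-xor; ∧-distribʳ-xor; ¬-not;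
    xor-same; xor-identityʳ; xor-∧-commutativeRing)
open import Algebra.Properties.CommutativeSemigroup
  (CommutativeRing.+-commutativeSemigroup xor-∧-commutativeRing) using (interchange)
open import Data.Fin using (Fin; zero; suc)
open import Data.Fin.Permutation using (↔⇒≡)
open import Data.Fin.Subset using (Subset; ∣_∣; _∈_; _∉_; ∁; _∩_; ⊥; Nonempty)
open import Data.Fin.Subset.Properties
  using (∩-comm; ∩-assoc; nonempty?; Empty-unique; ∣⊥∣≡0; ∣p∣≤n; ∣∁p∣≡n∸∣p∣; x∈∁p⇒x∉p; p∩q⊆q)
open import Data.Nat as ℕ using (ℕ; zero; suc; _+_; _∸_; _^_; _%_; _≡ᵇ_; z≤n; NonZero)
import Data.Nat.Properties as ℕ
open import Data.Nat.Tactic.RingSolver using (solve-∀)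
open import Data.Integer as ℤ using (+_)
import Data.Integer.Properties as ℤ
open import Data.Product using (∃; _×_; _,_; proj₁; proj₂)
open import Data.Rational as ℚ using (_/_; _*_; _≤_)
import Data.Rational.Properties as ℚ
open import Data.Rational.Unnormalised as ℚᵘ using (mkℚᵘ; *≤*)
import Data.Rational.Unnormalised.Properties as ℚᵘ
open import Data.Sum using (_⊎_; inj₁; inj₂)
open import Data.Vec using ([]; _∷_; Vec; here; there; lookup; map; tabulate; zipWith)
open import Data.Vec.Relation.Unary.All as All using (All; []; _∷_)
import Data.Vec.Relation.Unary.All.Properties as All
open import Data.Vec.Properties
  using (map-id; lookup∘tabulate; tabulate∘lookup; tabulate-cong; lookup-replicate; lookup-zipWith;
    lookup-map; zipWith-distribˡ; zipWith-distribʳ; []=⇒lookup; lookup⇒[]=)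
open import Function using (_∘_)
open import Relation.Binary.PropositionalEquality
  using (_≡_; _≢_; refl; sym; trans; cong; cong₂; subst; subst₂; module ≡-Reasoning)
open import Relation.Nullary using (¬_; yes; no; contradiction)

private
  variable
    m n : ℕ

-- Parity and symmetric difference as linear algebra over 𝔽₂.

-- Written as the xor of the bits, so that `odd (p ∩ q)` is the inner product of `p` and `q` over
-- 𝔽₂.
odd : Subset n → Bool
odd []      = false
odd (x ∷ p) = x xor odd p

infixl 6 _⊕_
_⊕_ : Subset n → Subset n → Subset n
_⊕_ = zipWith _xor_

suc-odd : ∀ k → (suc k % 2 ≡ᵇ 1) ≡ not (k % 2 ≡ᵇ 1)
suc-odd zero          = refl
suc-odd (suc zero)    = refl
suc-odd (suc (suc k)) = suc-odd k

∣∣-odd : (p : Subset n) → (∣ p ∣ % 2 ≡ᵇ 1) ≡ odd p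
∣∣-odd []          = refl
∣∣-odd (true ∷ p)  = trans (suc-odd ∣ p ∣) (cong not (∣∣-odd p))
∣∣-odd (false ∷ p) = ∣∣-odd p

odd-⊥-∩ : (p : Subset n) → odd (⊥ ∩ p) ≡ false
odd-⊥-∩ []      = refl
odd-⊥-∩ (x ∷ p) = odd-⊥-∩ p

odd⇒Nonempty : (p : Subset n) → odd p ≡ true → Nonempty p
odd⇒Nonempty (true ∷ p)  _ = zero , here
odd⇒Nonempty (false ∷ p) h with i , i∈p ← odd⇒Nonempty p h = suc i , there i∈p

odd-⊕ : (p q : Subset n) → odd (p ⊕ q) ≡ odd p xor odd q
odd-⊕ []      []      = refl
odd-⊕ (x ∷ p) (y ∷ q) =
  trans (cong ((x xor y) xor_) (odd-⊕ p q)) (interchange x y (odd p) (odd q))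

odd-∩-⊕ʳ : (p q r : Subset n) → odd (p ∩ (q ⊕ r)) ≡ odd (p ∩ q) xor odd (p ∩ r)
odd-∩-⊕ʳ p q r =
  trans (cong odd (zipWith-distribˡ ∧-distribˡ-xor p q r)) (odd-⊕ (p ∩ q) (p ∩ r))

odd-⊕-∩ : ∀ (p q r : Subset n) {i j} →
  odd (p ∩ r) ≡ i → odd (q ∩ r) ≡ j → odd ((p ⊕ q) ∩ r) ≡ i xor j
odd-⊕-∩ p q r h h′ = trans (cong odd (zipWith-distribʳ ∧-distribʳ-xor r p q))
  (trans (odd-⊕ (p ∩ r) (q ∩ r)) (cong₂ _xor_ h h′))

odd-∩-cancelʳ : ∀ (p q r : Subset n) → odd (p ∩ (q ⊕ r)) ≡ true →
  odd (p ∩ q) ≡ not (odd (p ∩ r))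
odd-∩-cancelʳ p q r h = xor-true _ _ (trans (sym (odd-∩-⊕ʳ p q r)) h)
  where
  xor-true : ∀ x y → x xor y ≡ true → x ≡ not y
  xor-true true  false _ = refl
  xor-true false true  _ = refl

-- Solvability of linear systems over 𝔽₂.

-- The matrix with columns `A` applied to the vector `p`.
combination : Vec (Subset m) n → Subset n → Subset m
combination []      []      = ⊥
combination (a ∷ A) (x ∷ p) = map (x ∧_) a ⊕ combination A p

lookup-combination : (A : Vec (Subset m) n) (p : Subset n) (v : Fin m) →
  lookup (combination A p) v ≡ odd (map (λ a → lookup a v) A ∩ p)
lookup-combination []      []      v = lookup-replicate v false
lookup-combination (a ∷ A) (x ∷ p) v =
  trans (lookup-zipWith _xor_ v (map (x ∧_) a) (combination A p))
        (cong₂ _xor_ (trans (lookup-map v (x ∧_) a) (∧-comm x (lookup a v)))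
                     (lookup-combination A p v))

⊕-cancelˡ : (a b : Subset m) → a ⊕ (b ⊕ a) ≡ b
⊕-cancelˡ []      []      = refl
⊕-cancelˡ (x ∷ a) (y ∷ b) = cong₂ _∷_ (cancel x y) (⊕-cancelˡ a b)
  where
  cancel : ∀ x y → x xor (y xor x) ≡ y
  cancel false y     = xor-identityʳ y
  cancel true  false = refl
  cancel true  true  = refl

skip-column : (a c : Subset m) → map (false ∧_) a ⊕ c ≡ c
skip-column []      []      = refl
skip-column (x ∷ a) (y ∷ c) = cong (y ∷_) (skip-column a c)

-- Pairing with the unit vector at the first nonzero coordinate detects a nonzero `b`. This settles
-- `fredholm` for a matrix without columns.
⊥-or-detected : (b : Subset m) → b ≡ ⊥ ⊎ ∃ λ y → odd (y ∩ b) ≡ true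
⊥-or-detected []          = inj₁ refl
⊥-or-detected (true ∷ b)  = inj₂ (true ∷ ⊥ , cong not (odd-⊥-∩ b))
⊥-or-detected (false ∷ b) with ⊥-or-detected b
... | inj₁ b≡⊥     = inj₁ (cong (false ∷_) b≡⊥)
... | inj₂ (y , h) = inj₂ (false ∷ y , h)

-- A functional that kills every column but not `b`, which places `b` outside the column span.
Certificate : Vec (Subset m) n → Subset m → Set
Certificate A b = ∃ λ y → All (λ a → odd (y ∩ a) ≡ false) A × odd (y ∩ b) ≡ true

-- If y separates b from the remaining columns but not from a, then the alternative for b + a
-- gives either a solution using a, or a second functional y′ such that one of y′ and y + y′
-- kills a and still detects b.
fredholm : (A : Vec (Subset m) n) (b : Subset m) →
  (∃ λ x → combination A x ≡ b) ⊎ Certificate A b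
fredholm [] b with ⊥-or-detected b
... | inj₁ b≡⊥     = inj₁ ([] , sym b≡⊥)
... | inj₂ (y , h) = inj₂ (y , [] , h)
fredholm (a ∷ A) b with fredholm A b
... | inj₁ (x , eq) = inj₁ (false ∷ x , trans (skip-column a _) eq)
... | inj₂ (y , y⊥A , yb) with odd (y ∩ a) in ya
...   | false = inj₂ (y , ya ∷ y⊥A , yb)
...   | true with fredholm A (b ⊕ a)
...     | inj₁ (x , eq) = inj₁ (true ∷ x , trans (cong₂ _⊕_ (map-id a) eq) (⊕-cancelˡ a b))
...     | inj₂ (y′ , y′⊥A , y′b⊕a) with odd (y′ ∩ a) in y′a
...       | false = inj₂ (y′ , y′a ∷ y′⊥A , trans (odd-∩-cancelʳ y′ b a y′b⊕a) (cong not y′a))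
...       | true  = inj₂
  ( y ⊕ y′
  , odd-⊕-∩ y y′ a ya y′a
    ∷ All.map (λ { {c} (h , h′) → odd-⊕-∩ y y′ c h h′ }) (All.zip (y⊥A , y′⊥A))
  , odd-⊕-∩ y y′ b yb (trans (odd-∩-cancelʳ y′ b a y′b⊕a) (cong not y′a)) )

-- Weak odd domination as a linear system.

lookup-ext : {A : Set} {xs ys : Vec A n} → (∀ i → lookup xs i ≡ lookup ys i) → xs ≡ ys
lookup-ext {xs = xs} {ys} h =
  trans (sym (tabulate∘lookup xs)) (trans (tabulate-cong h) (tabulate∘lookup ys))

module _ (G : Graph) where
  open Graph G using (adjacent; symmetric)

  lookup-Odd : ∀ C v → lookup (Odd G C) v ≡ odd (N G v ∩ C)
  lookup-Odd C v = trans (lookup∘tabulate _ v) (∣∣-odd (N G v ∩ C))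

  module _ (B : Subset (order G)) where

    -- Column `j` is zero for `j` in `B` and N(j) ∩ B otherwise: only vertices outside `B` can be
    -- chosen, and only vertices of `B` impose an equation. Solvability with right-hand side `B` is
    -- then the WOD condition.
    columns : Vec (Subset (order G)) (order G)
    columns = tabulate λ j → map (not (lookup B j) ∧_) (N G j ∩ B)

    -- By symmetry of adjacency, row `v` of the matrix is N(v) ∩ ∁B, so its product with `x` is the
    -- parity of the neighbours of `v` in `x ∩ ∁ B`.
    row-of-columns : ∀ {v} → lookup B v ≡ true → ∀ x →
      map (λ a → lookup a v) columns ∩ x ≡ N G v ∩ (x ∩ ∁ B)
    row-of-columns {v} Bv x = lookup-ext λ j → begin
      lookup (map (λ a → lookup a v) columns ∩ x) j
        ≡⟨ lookup-zipWith _∧_ j (map (λ a → lookup a v) columns) x ⟩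
      lookup (map (λ a → lookup a v) columns) j ∧ lookup x j
        ≡⟨ cong (_∧ lookup x j) (entry j) ⟩
      (not (lookup B j) ∧ adjacent v j) ∧ lookup x j
        ≡⟨ rearrange (not (lookup B j)) (adjacent v j) (lookup x j) ⟩
      adjacent v j ∧ (lookup x j ∧ not (lookup B j))
        ≡⟨ cong₂ (λ s t → s ∧ (lookup x j ∧ t)) (lookup∘tabulate (adjacent v) j) (lookup-map j not B) ⟨
      lookup (N G v) j ∧ (lookup x j ∧ lookup (∁ B) j)
        ≡⟨ cong (lookup (N G v) j ∧_) (lookup-zipWith _∧_ j x (∁ B)) ⟨
      lookup (N G v) j ∧ lookup (x ∩ ∁ B) j
        ≡⟨ lookup-zipWith _∧_ j (N G v) (x ∩ ∁ B) ⟨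
      lookup (N G v ∩ (x ∩ ∁ B)) j ∎
      where
      open ≡-Reasoning
      rearrange : ∀ b e c → (b ∧ e) ∧ c ≡ e ∧ (c ∧ b)
      rearrange b e c = trans (∧-assoc b e c) (trans (∧-comm b (e ∧ c)) (∧-assoc e c b))
      entry : ∀ j → lookup (map (λ a → lookup a v) columns) j ≡ not (lookup B j) ∧ adjacent v j
      entry j = begin
        lookup (map (λ a → lookup a v) columns) j
          ≡⟨ lookup-map j _ columns ⟩
        lookup (lookup columns j) v
          ≡⟨ cong (λ a → lookup a v) (lookup∘tabulate _ j) ⟩
        lookup (map (not (lookup B j) ∧_) (N G j ∩ B)) v
          ≡⟨ lookup-map v _ (N G j ∩ B) ⟩
        not (lookup B j) ∧ lookup (N G j ∩ B) v
          ≡⟨ cong (not (lookup B j) ∧_) (lookup-zipWith _∧_ v (N G j) B) ⟩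
        not (lookup B j) ∧ (lookup (N G j) v ∧ lookup B v)
          ≡⟨ cong₂ (λ s t → not (lookup B j) ∧ (s ∧ t)) (lookup∘tabulate (adjacent j) v) Bv ⟩
        not (lookup B j) ∧ (adjacent j v ∧ true)
          ≡⟨ cong (not (lookup B j) ∧_) (trans (∧-identityʳ _) (symmetric j v)) ⟩
        not (lookup B j) ∧ adjacent v j ∎

    -- A solution `x` yields the dominating set `x ∩ ∁ B`. A certificate `y` yields `D = y ∩ B`: it
    -- is nonempty because its size is odd, and killing the column of `v ∉ B` means that `v` has
    -- evenly many neighbours in `D`.
    WOD⊎odd-witness : WOD G B ⊎
      ∃ λ D → Nonempty D × (∀ v → v ∉ B → lookup D v ≡ false × lookup (Odd G D) v ≡ false)
    WOD⊎odd-witness with fredholm columns B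
    ... | inj₁ (x , eq) = inj₁ (x ∩ ∁ B , p∩q⊆q x (∁ B) , λ {v} v∈B →
      lookup⇒[]= v (Odd G (x ∩ ∁ B)) (solves v ([]=⇒lookup v∈B)))
      where
      open ≡-Reasoning
      solves : ∀ v → lookup B v ≡ true → lookup (Odd G (x ∩ ∁ B)) v ≡ true
      solves v Bv = begin
        lookup (Odd G (x ∩ ∁ B)) v                     ≡⟨ lookup-Odd (x ∩ ∁ B) v ⟩
        odd (N G v ∩ (x ∩ ∁ B))                        ≡⟨ cong odd (row-of-columns Bv x) ⟨
        odd (map (λ a → lookup a v) columns ∩ x)       ≡⟨ lookup-combination columns x v ⟨
        lookup (combination columns x) v               ≡⟨ cong (λ b → lookup b v) eq ⟩
        lookup B v                                     ≡⟨ Bv ⟩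
        true                                           ∎
    ... | inj₂ (y , y⊥A , yB) = inj₂ (y ∩ B , odd⇒Nonempty (y ∩ B) yB , λ v v∉B →
      outside v (Bv≡false v∉B) , even v (Bv≡false v∉B))
      where
      open ≡-Reasoning
      Bv≡false : ∀ {v} → v ∉ B → lookup B v ≡ false
      Bv≡false {v} v∉B = ¬-not (v∉B ∘ lookup⇒[]= v B)
      outside : ∀ v → lookup B v ≡ false → lookup (y ∩ B) v ≡ false
      outside v Bv = trans (lookup-zipWith _∧_ v y B)
        (trans (cong (lookup y v ∧_) Bv) (∧-zeroʳ _))
      even : ∀ v → lookup B v ≡ false → lookup (Odd G (y ∩ B)) v ≡ false
      even v Bv = begin
        lookup (Odd G (y ∩ B)) v     ≡⟨ lookup-Odd (y ∩ B) v ⟩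
        odd (N G v ∩ (y ∩ B))        ≡⟨ cong odd (x∙yz≈y∙xz (N G v) y B) ⟩
        odd (y ∩ (N G v ∩ B))        ≡⟨ cong (λ a → odd (y ∩ a)) column ⟨
        odd (y ∩ lookup columns v)   ≡⟨ All.lookup⁺ y⊥A v ⟩
        false                        ∎
        where
        column : lookup columns v ≡ N G v ∩ B
        column = trans (lookup∘tabulate _ v)
          (trans (cong (λ t → map (not t ∧_) (N G v ∩ B)) Bv) (map-id (N G v ∩ B)))
        x∙yz≈y∙xz : ∀ p q r → p ∩ (q ∩ r) ≡ q ∩ (p ∩ r)
        x∙yz≈y∙xz p q r =
          trans (sym (∩-assoc p q r)) (trans (cong (_∩ r) (∩-comm p q)) (∩-assoc q p r))

  -- The common shape of both extremal problems: `s = true` describes a set `S` dominated by `C`,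
  -- and `s = false` arises for the complement `S` of a non-WOD set with witness `C`.
  Uniform : Bool → Subset (order G) → Subset (order G) → Set
  Uniform s C S = ∀ v → v ∈ S → lookup C v ≡ false × lookup (Odd G C) v ≡ s

  κQ-upper : ∀ c → (∀ s S C → Nonempty C → Uniform s C S → ∣ S ∣ ℕ.≤ c) → κQ G ℕ.≤ c
  κQ-upper c bound = ℕ.⊔-lub κ≤c n∸κ′≤c
    where
    κ≤c : κ G ℕ.≤ c
    κ≤c with κ-attained G
    ... | B , (C , C⊆∁B , B⊆OddC) , ∣B∣≡κ with nonempty? B
    -- An empty `B` may have an empty dominating set, which `bound` does not cover; here `κ` is 0.
    ...   | no B≡∅ = ℕ.≤-trans (ℕ.≤-reflexive κ≡0) z≤n
      where
      κ≡0 : κ G ≡ 0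
      κ≡0 = trans (sym ∣B∣≡κ) (trans (cong ∣_∣ (Empty-unique B≡∅)) (∣⊥∣≡0 (order G)))
    ...   | yes (u , u∈B) = subst (ℕ._≤ c) ∣B∣≡κ (bound true B C C≢∅ uniform)
      where
      -- A vertex of `B` has an odd number of neighbours in `C`, hence at least one.
      C≢∅ : Nonempty C
      C≢∅ with odd⇒Nonempty (N G u ∩ C)
                 (trans (sym (lookup-Odd C u)) ([]=⇒lookup (B⊆OddC u∈B)))
      ... | w , w∈N∩C = w , p∩q⊆q (N G u) C w∈N∩C
      uniform : Uniform true C B
      uniform v v∈B = ¬-not (λ Cv → x∈∁p⇒x∉p (C⊆∁B (lookup⇒[]= v C Cv)) v∈B)
        , []=⇒lookup (B⊆OddC v∈B)

    n∸κ′≤c : order G ∸ κ′ G ℕ.≤ c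
    n∸κ′≤c with κ′-attained G
    ... | B , ¬wod , ∣B∣≡κ′ with WOD⊎odd-witness B
    ...   | inj₁ wod = contradiction wod ¬wod
    ...   | inj₂ (D , D≢∅ , uniform) = subst (ℕ._≤ c)
      (trans (∣∁p∣≡n∸∣p∣ B) (cong (order G ∸_) ∣B∣≡κ′))
      (bound false (∁ B) D D≢∅ λ v v∈∁B → uniform v (x∈∁p⇒x∉p v∈∁B))

-- Sums over subsets and averaging.

∑ : (Subset n → ℕ) → ℕ
∑ {zero}  f = f []
∑ {suc n} f = ∑ (f ∘ (false ∷_)) + ∑ (f ∘ (true ∷_))

-- The sum over the nonempty subsets.
∑⁺ : (Subset n → ℕ) → ℕ
∑⁺ {zero}  f = 0
∑⁺ {suc n} f = ∑⁺ (f ∘ (false ∷_)) + ∑ (f ∘ (true ∷_))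

+-interchange : ∀ a b c d → (a + b) + (c + d) ≡ (a + c) + (b + d)
+-interchange = solve-∀

∑-+ : (f g : Subset n → ℕ) → ∑ (λ p → f p + g p) ≡ ∑ f + ∑ g
∑-+ {zero}  f g = refl
∑-+ {suc n} f g = trans
  (cong₂ _+_ (∑-+ (f ∘ (false ∷_)) (g ∘ (false ∷_))) (∑-+ (f ∘ (true ∷_)) (g ∘ (true ∷_))))
  (+-interchange (∑ (f ∘ (false ∷_))) _ _ _)

∑⁺-+ : (f g : Subset n → ℕ) → ∑⁺ (λ p → f p + g p) ≡ ∑⁺ f + ∑⁺ g
∑⁺-+ {zero}  f g = refl
∑⁺-+ {suc n} f g = trans
  (cong₂ _+_ (∑⁺-+ (f ∘ (false ∷_)) (g ∘ (false ∷_))) (∑-+ (f ∘ (true ∷_)) (g ∘ (true ∷_))))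
  (+-interchange (∑⁺ (f ∘ (false ∷_))) _ _ _)

∑-cong : {f g : Subset n → ℕ} → (∀ p → f p ≡ g p) → ∑ f ≡ ∑ g
∑-cong {zero}  h = h []
∑-cong {suc n} h = cong₂ _+_ (∑-cong (h ∘ (false ∷_))) (∑-cong (h ∘ (true ∷_)))

∑⁺-cong : {f g : Subset n → ℕ} → (∀ p → Nonempty p → f p ≡ g p) → ∑⁺ f ≡ ∑⁺ g
∑⁺-cong {zero}  h = refl
∑⁺-cong {suc n} h = cong₂ _+_
  (∑⁺-cong λ p (i , i∈p) → h (false ∷ p) (suc i , there i∈p))
  (∑-cong λ p → h (true ∷ p) (zero , here))

∑-* : ∀ c (f : Subset n → ℕ) → ∑ (λ p → c ℕ.* f p) ≡ c ℕ.* ∑ f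
∑-* {zero}  c f = refl
∑-* {suc n} c f = trans (cong₂ _+_ (∑-* c (f ∘ (false ∷_))) (∑-* c (f ∘ (true ∷_))))
  (sym (ℕ.*-distribˡ-+ c (∑ (f ∘ (false ∷_))) _))

∑⁺-* : ∀ c (f : Subset n → ℕ) → ∑⁺ (λ p → c ℕ.* f p) ≡ c ℕ.* ∑⁺ f
∑⁺-* {zero}  c f = sym (ℕ.*-zeroʳ c)
∑⁺-* {suc n} c f = trans (cong₂ _+_ (∑⁺-* c (f ∘ (false ∷_))) (∑-* c (f ∘ (true ∷_))))
  (sym (ℕ.*-distribˡ-+ c (∑⁺ (f ∘ (false ∷_))) _))

-- `F` stands for any additive functional, so that one induction serves both `∑` and `∑⁺`.
∑-swap : (F : (Subset m → ℕ) → ℕ) → (∀ f g → F (λ q → f q + g q) ≡ F f + F g) →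
  (f : Subset n → Subset m → ℕ) → ∑ (λ p → F (f p)) ≡ F (λ q → ∑ (λ p → f p q))
∑-swap {n = zero}  F F-+ f = refl
∑-swap {n = suc n} F F-+ f =
  trans (cong₂ _+_ (∑-swap F F-+ (f ∘ (false ∷_))) (∑-swap F F-+ (f ∘ (true ∷_))))
        (sym (F-+ _ _))

term≤∑ : (f : Subset n → ℕ) (p : Subset n) → f p ℕ.≤ ∑ f
term≤∑ f []          = ℕ.≤-refl
term≤∑ f (false ∷ p) = ℕ.≤-trans (term≤∑ (f ∘ (false ∷_)) p) (ℕ.m≤m+n _ _)
term≤∑ f (true ∷ p)  = ℕ.≤-trans (term≤∑ (f ∘ (true ∷_)) p) (ℕ.m≤n+m _ _)

term≤∑⁺ : (f : Subset n → ℕ) (p : Subset n) → Nonempty p → f p ℕ.≤ ∑⁺ f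
term≤∑⁺ f (false ∷ p) (suc i , there i∈p) =
  ℕ.≤-trans (term≤∑⁺ (f ∘ (false ∷_)) p (i , i∈p)) (ℕ.m≤m+n _ _)
term≤∑⁺ f (true ∷ p)  _ = ℕ.≤-trans (term≤∑ (f ∘ (true ∷_)) p) (ℕ.m≤n+m _ _)

doubling : ∀ k x → k ℕ.* x + k ℕ.* x ≡ 2 ℕ.* k ℕ.* x
doubling = solve-∀

-- The smaller of the values found in the two halves is at most the average over both. Multiplying
-- by `2 ^ n` avoids division.
∃-below-average : (f : Subset n → ℕ) → ∃ λ p → 2 ^ n ℕ.* f p ℕ.≤ ∑ f
∃-below-average {zero}  f = [] , ℕ.≤-reflexive (ℕ.*-identityˡ _)
∃-below-average {suc n} f
  with p , hp ← ∃-below-average (f ∘ (false ∷_))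
  with q , hq ← ∃-below-average (f ∘ (true ∷_))
  with ℕ.≤-total (f (false ∷ p)) (f (true ∷ q))
... | inj₁ p≤q = false ∷ p , ℕ.≤-trans (ℕ.≤-reflexive (sym (doubling (2 ^ n) _)))
  (ℕ.+-mono-≤ hp (ℕ.≤-trans (ℕ.*-monoʳ-≤ (2 ^ n) p≤q) hq))
... | inj₂ q≤p = true ∷ q , ℕ.≤-trans (ℕ.≤-reflexive (sym (doubling (2 ^ n) _)))
  (ℕ.+-mono-≤ (ℕ.≤-trans (ℕ.*-monoʳ-≤ (2 ^ n) q≤p) hp) hq)

-- Toggling an element of `p` in `q` flips the parity of `q ∩ p`, so both parities are equally
-- frequent. The factor 2 avoids halving `2 ^ n`.
parity-balanced : (f : Bool → ℕ) (p : Subset n) → Nonempty p →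
  2 ℕ.* ∑ (λ q → f (odd (q ∩ p))) ≡ 2 ^ n ℕ.* (f false + f true)
parity-balanced {suc n} f (true ∷ p) _ = begin
  2 ℕ.* (∑ (λ q → f (odd (q ∩ p))) + ∑ (λ q → f (not (odd (q ∩ p)))))
    ≡⟨ cong (2 ℕ.*_) (trans (sym (∑-+ {n} _ _)) (∑-cong {n} λ q → both (odd (q ∩ p)))) ⟩
  2 ℕ.* ∑ {n} (λ _ → f false + f true)
    ≡⟨ cong (2 ℕ.*_) (∑-const n (f false + f true)) ⟩
  2 ℕ.* (2 ^ n ℕ.* (f false + f true))
    ≡⟨ ℕ.*-assoc 2 (2 ^ n) _ ⟨
  2 ^ suc n ℕ.* (f false + f true) ∎
  where
  open ≡-Reasoning
  both : ∀ x → f x + f (not x) ≡ f false + f true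
  both false = refl
  both true  = ℕ.+-comm (f true) (f false)
  ∑-const : ∀ n c → ∑ {n} (λ _ → c) ≡ 2 ^ n ℕ.* c
  ∑-const zero    c = sym (ℕ.*-identityˡ c)
  ∑-const (suc n) c = trans (cong₂ _+_ (∑-const n c) (∑-const n c)) (doubling (2 ^ n) c)
parity-balanced {suc n} f (false ∷ p) (suc i , there i∈p) = begin
  2 ℕ.* (∑ (λ q → f (odd (q ∩ p))) + ∑ (λ q → f (odd (q ∩ p))))
    ≡⟨ ℕ.*-distribˡ-+ 2 (∑ (λ q → f (odd (q ∩ p)))) _ ⟩
  2 ℕ.* ∑ (λ q → f (odd (q ∩ p))) + 2 ℕ.* ∑ (λ q → f (odd (q ∩ p)))
    ≡⟨ cong₂ _+_ ih ih ⟩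
  2 ^ n ℕ.* (f false + f true) + 2 ^ n ℕ.* (f false + f true)
    ≡⟨ doubling (2 ^ n) (f false + f true) ⟩
  2 ^ suc n ℕ.* (f false + f true) ∎
  where
  open ≡-Reasoning
  ih = parity-balanced f p (i , i∈p)

-- Graphs encoded vertex by vertex.

-- A graph on Fin n, given by the neighbourhood of each vertex among the larger ones.
data Triangle : ℕ → Set where
  []  : Triangle 0
  _▹_ : Subset n → Triangle n → Triangle (suc n)

row : Triangle n → Fin n → Subset n
row (p ▹ t) zero    = false ∷ p
row (p ▹ t) (suc i) = lookup p i ∷ row t i

row-symmetric : (t : Triangle n) (u v : Fin n) → lookup (row t u) v ≡ lookup (row t v) u
row-symmetric (p ▹ t) zero    zero    = refl
row-symmetric (p ▹ t) zero    (suc v) = refl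
row-symmetric (p ▹ t) (suc u) zero    = refl
row-symmetric (p ▹ t) (suc u) (suc v) = row-symmetric t u v

row-loopless : (t : Triangle n) (v : Fin n) → lookup (row t v) v ≡ false
row-loopless (p ▹ t) zero    = refl
row-loopless (p ▹ t) (suc v) = row-loopless t v

graph : ⦃ NonZero n ⦄ → Triangle n → Graph
graph {n} t = record
  { order     = n
  ; adjacent  = λ u v → lookup (row t u) v
  ; symmetric = row-symmetric t
  ; loopless  = row-loopless t
  }

-- Odd(C) in recursive form: a new vertex in `C` adds its neighbourhood `p` to the parities of the
-- others, and one outside `C` leaves them unchanged. The dependence on `p` is thus explicit when
-- averaging over `p`.
parities : Triangle n → Subset n → Subset n
parities []      []          = []
parities (p ▹ t) (false ∷ C) = odd (p ∩ C) ∷ parities t C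
parities (p ▹ t) (true ∷ C)  = odd (p ∩ C) ∷ (p ⊕ parities t C)

lookup-parities : (t : Triangle n) (C : Subset n) (v : Fin n) →
  lookup (parities t C) v ≡ odd (row t v ∩ C)
lookup-parities (p ▹ t) (false ∷ C) zero    = refl
lookup-parities (p ▹ t) (true ∷ C)  zero    = refl
lookup-parities (p ▹ t) (false ∷ C) (suc i) =
  trans (lookup-parities t C i) (cong (_xor odd (row t i ∩ C)) (sym (∧-zeroʳ (lookup p i))))
lookup-parities (p ▹ t) (true ∷ C)  (suc i) = trans (lookup-zipWith _xor_ i p (parities t C))
  (cong₂ _xor_ (sym (∧-identityʳ (lookup p i))) (lookup-parities t C i))

lookup-Odd-graph : ⦃ _ : NonZero n ⦄ (t : Triangle n) (C : Subset n) (v : Fin n) →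
  lookup (Odd (graph t) C) v ≡ lookup (parities t C) v
lookup-Odd-graph t C v = trans (lookup-Odd (graph t) C v)
  (trans (cong (λ p → odd (p ∩ C)) (tabulate∘lookup (row t v))) (sym (lookup-parities t C v)))

-- The first moment method, made constructive.

module FirstMoment (a b : ℕ) where

  -- With s = false the cheap factor a marks C ∪ Odd(C), with s = true it marks C ∪ (V ∖ Odd(C)).
  weight : (s inC odd : Bool) → ℕ
  weight s true  _ = a
  weight s false x = if x xor s then a else b

  weights : Bool → Subset n → Subset n → ℕ
  weights s []      []      = 1
  weights s (c ∷ C) (x ∷ P) = weight s c x ℕ.* weights s C P

  -- The empty set is left out: all its parities are even, so for `s = false` it would contribute
  -- `b ^ n` in every graph.
  potential : Bool → Triangle n → ℕ
  potential s t = ∑⁺ λ C → weights s C (parities t C)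

  weight-sum : ∀ s c x → weight s c x + weight s c (not x) ≡ (if c then 2 ℕ.* a else a + b)
  weight-sum s     true  x     = cong (λ k → a + k) (sym (ℕ.+-identityʳ a))
  weight-sum false false false = ℕ.+-comm b a
  weight-sum false false true  = refl
  weight-sum true  false false = refl
  weight-sum true  false true  = ℕ.+-comm b a

  -- The sum of `weights s C` over all parity vectors in product form, the same for both values of
  -- `s`.
  totals : Subset n → ℕ
  totals []      = 1
  totals (c ∷ C) = (if c then 2 ℕ.* a else a + b) ℕ.* totals C

  -- Translation by `P` permutes the subsets, so the parities act as independent fair bits and the
  -- sum factors over the vertices.
  ∑-weights-⊕ : ∀ s (C P : Subset n) → ∑ (λ p → weights s C (p ⊕ P)) ≡ totals C
  ∑-weights-⊕ s []      []      = refl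
  ∑-weights-⊕ {suc n} s (c ∷ C) (x ∷ P) = begin
    ∑ (λ p → weight s c x ℕ.* weights s C (p ⊕ P))
      + ∑ (λ p → weight s c (not x) ℕ.* weights s C (p ⊕ P))
      ≡⟨ cong₂ _+_ (∑-* {n} (weight s c x) _) (∑-* {n} (weight s c (not x)) _) ⟩
    weight s c x ℕ.* ∑ (λ p → weights s C (p ⊕ P))
      + weight s c (not x) ℕ.* ∑ (λ p → weights s C (p ⊕ P))
      ≡⟨ ℕ.*-distribʳ-+ _ (weight s c x) (weight s c (not x)) ⟨
    (weight s c x + weight s c (not x)) ℕ.* ∑ (λ p → weights s C (p ⊕ P))
      ≡⟨ cong₂ ℕ._*_ (weight-sum s c x) (∑-weights-⊕ s C P) ⟩
    totals (c ∷ C) ∎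
    where open ≡-Reasoning

  ∑-totals : ∀ n → ∑ {n} totals ≡ (3 ℕ.* a + b) ^ n
  ∑-totals zero    = refl
  ∑-totals (suc n) = begin
    ∑ {n} (λ C → (a + b) ℕ.* totals C) + ∑ {n} (λ C → 2 ℕ.* a ℕ.* totals C)
      ≡⟨ cong₂ _+_ (∑-* {n} (a + b) totals) (∑-* {n} (2 ℕ.* a) totals) ⟩
    (a + b) ℕ.* ∑ {n} totals + 2 ℕ.* a ℕ.* ∑ {n} totals
      ≡⟨ cong (λ k → (a + b) ℕ.* k + 2 ℕ.* a ℕ.* k) (∑-totals n) ⟩
    (a + b) ℕ.* (3 ℕ.* a + b) ^ n + 2 ℕ.* a ℕ.* (3 ℕ.* a + b) ^ n
      ≡⟨ eq a b ((3 ℕ.* a + b) ^ n) ⟩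
    (3 ℕ.* a + b) ^ suc n ∎
    where
    open ≡-Reasoning
    eq : ∀ a b k → (a + b) ℕ.* k + 2 ℕ.* a ℕ.* k ≡ (3 ℕ.* a + b) ℕ.* k
    eq = solve-∀

  -- A nonempty `C` avoiding the new vertex keeps its weight and gains a factor of average (a + b) /
  -- 2, by `parity-balanced`. A `C` containing it gains the factor `a`, and adding a uniform `p`
  -- makes the other parities uniform. Such a `C` may have no further element, hence the full sum in
  -- the second case.
  ∑-potential-▹ : ∀ s (t : Triangle n) → 2 ℕ.* ∑ (λ p → potential s (p ▹ t)) ≡
    2 ^ n ℕ.* (a + b) ℕ.* potential s t + 2 ℕ.* (a ℕ.* (3 ℕ.* a + b) ^ n)
  ∑-potential-▹ {n} s t = begin
    2 ℕ.* ∑ (λ p → ∑⁺ (out p) + ∑ (into p))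
      ≡⟨ cong (2 ℕ.*_) (∑-+ {n} _ _) ⟩
    2 ℕ.* (∑ (λ p → ∑⁺ (out p)) + ∑ (λ p → ∑ (into p)))
      ≡⟨ ℕ.*-distribˡ-+ 2 (∑ (λ p → ∑⁺ (out p))) _ ⟩
    2 ℕ.* ∑ (λ p → ∑⁺ (out p)) + 2 ℕ.* ∑ (λ p → ∑ (into p))
      ≡⟨ cong₂ _+_ outside (cong (2 ℕ.*_) inside) ⟩
    2 ^ n ℕ.* (a + b) ℕ.* potential s t + 2 ℕ.* (a ℕ.* (3 ℕ.* a + b) ^ n) ∎
    where
    open ≡-Reasoning
    W : Subset n → ℕ
    W C = weights s C (parities t C)
    out : Subset n → Subset n → ℕ
    out p C = weight s false (odd (p ∩ C)) ℕ.* W C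
    into : Subset n → Subset n → ℕ
    into p C = a ℕ.* weights s C (p ⊕ parities t C)
    outside : 2 ℕ.* ∑ (λ p → ∑⁺ (out p)) ≡ 2 ^ n ℕ.* (a + b) ℕ.* potential s t
    outside = begin
      2 ℕ.* ∑ (λ p → ∑⁺ (out p))
        ≡⟨ cong (2 ℕ.*_) (∑-swap ∑⁺ ∑⁺-+ out) ⟩
      2 ℕ.* ∑⁺ (λ C → ∑ (λ p → out p C))
        ≡⟨ ∑⁺-* {n} 2 _ ⟨
      ∑⁺ (λ C → 2 ℕ.* ∑ (λ p → out p C))
        ≡⟨ ∑⁺-cong each ⟩
      ∑⁺ (λ C → 2 ^ n ℕ.* (a + b) ℕ.* W C)
        ≡⟨ ∑⁺-* (2 ^ n ℕ.* (a + b)) W ⟩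
      2 ^ n ℕ.* (a + b) ℕ.* potential s t ∎
      where
      each : ∀ C → Nonempty C → 2 ℕ.* ∑ (λ p → out p C) ≡ 2 ^ n ℕ.* (a + b) ℕ.* W C
      each C C≢∅ = begin
        2 ℕ.* ∑ (λ p → out p C)
          ≡⟨ cong (2 ℕ.*_) (∑-cong λ p → ℕ.*-comm (weight s false (odd (p ∩ C))) (W C)) ⟩
        2 ℕ.* ∑ (λ p → W C ℕ.* weight s false (odd (p ∩ C)))
          ≡⟨ cong (2 ℕ.*_) (∑-* {n} (W C) _) ⟩
        2 ℕ.* (W C ℕ.* ∑ (λ p → weight s false (odd (p ∩ C))))
          ≡⟨ eq (W C) _ ⟩
        2 ℕ.* ∑ (λ p → weight s false (odd (p ∩ C))) ℕ.* W C
          ≡⟨ cong (ℕ._* W C) (parity-balanced (weight s false) C C≢∅) ⟩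
        2 ^ n ℕ.* (weight s false false + weight s false true) ℕ.* W C
          ≡⟨ cong (λ k → 2 ^ n ℕ.* k ℕ.* W C) (weight-sum s false false) ⟩
        2 ^ n ℕ.* (a + b) ℕ.* W C ∎
        where
        eq : ∀ w k → 2 ℕ.* (w ℕ.* k) ≡ 2 ℕ.* k ℕ.* w
        eq = solve-∀
    inside : ∑ (λ p → ∑ (into p)) ≡ a ℕ.* (3 ℕ.* a + b) ^ n
    inside = begin
      ∑ (λ p → ∑ (into p))
        ≡⟨ ∑-swap ∑ ∑-+ into ⟩
      ∑ (λ C → ∑ (λ p → into p C))
        ≡⟨ ∑-cong (λ C → trans (∑-* a (λ p → weights s C (p ⊕ parities t C)))
             (cong (a ℕ.*_) (∑-weights-⊕ s C (parities t C)))) ⟩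
      ∑ {n} (λ C → a ℕ.* totals C)
        ≡⟨ ∑-* {n} a totals ⟩
      a ℕ.* ∑ {n} totals
        ≡⟨ cong (a ℕ.*_) (∑-totals n) ⟩
      a ℕ.* (3 ℕ.* a + b) ^ n ∎

  total : Triangle n → ℕ
  total t = potential false t + potential true t

  -- Vertices are added one at a time, each with a neighbourhood of below-average total.
  ∃-small-total : ∀ n → ∃ λ (t : Triangle n) → 2 ^ n ℕ.* total t ℕ.≤ 2 ℕ.* (3 ℕ.* a + b) ^ n
  ∃-small-total zero    = [] , z≤n
  ∃-small-total (suc n) with t , ht ← ∃-small-total n
                     with p , hp ← ∃-below-average (λ p → total (p ▹ t)) = p ▹ t , (begin
    2 ^ suc n ℕ.* total (p ▹ t)
      ≡⟨ ℕ.*-assoc 2 (2 ^ n) _ ⟩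
    2 ℕ.* (2 ^ n ℕ.* total (p ▹ t))
      ≤⟨ ℕ.*-monoʳ-≤ 2 hp ⟩
    2 ℕ.* ∑ (λ p → total (p ▹ t))
      ≡⟨ cong (2 ℕ.*_) (∑-+ (λ p → potential false (p ▹ t)) (λ p → potential true (p ▹ t))) ⟩
    2 ℕ.* (∑ (λ p → potential false (p ▹ t)) + ∑ (λ p → potential true (p ▹ t)))
      ≡⟨ ℕ.*-distribˡ-+ 2 (∑ (λ p → potential false (p ▹ t))) _ ⟩
    2 ℕ.* ∑ (λ p → potential false (p ▹ t)) + 2 ℕ.* ∑ (λ p → potential true (p ▹ t))
      ≡⟨ cong₂ _+_ (∑-potential-▹ false t) (∑-potential-▹ true t) ⟩
    (2 ^ n ℕ.* (a + b) ℕ.* potential false t + 2 ℕ.* (a ℕ.* M ^ n))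
      + (2 ^ n ℕ.* (a + b) ℕ.* potential true t + 2 ℕ.* (a ℕ.* M ^ n))
      ≡⟨ collect (2 ^ n) a b (potential false t) (potential true t) (M ^ n) ⟩
    (a + b) ℕ.* (2 ^ n ℕ.* total t) + 4 ℕ.* (a ℕ.* M ^ n)
      ≤⟨ ℕ.+-monoˡ-≤ _ (ℕ.*-monoʳ-≤ (a + b) ht) ⟩
    (a + b) ℕ.* (2 ℕ.* M ^ n) + 4 ℕ.* (a ℕ.* M ^ n)
      ≡⟨ close a b (M ^ n) ⟩
    2 ℕ.* M ^ suc n ∎)
    where
    open ℕ.≤-Reasoning
    M = 3 ℕ.* a + b
    collect : ∀ k a b x y z →
      (k ℕ.* (a + b) ℕ.* x + 2 ℕ.* (a ℕ.* z)) + (k ℕ.* (a + b) ℕ.* y + 2 ℕ.* (a ℕ.* z))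
        ≡ (a + b) ℕ.* (k ℕ.* (x + y)) + 4 ℕ.* (a ℕ.* z)
    collect = solve-∀
    close : ∀ a b z → (a + b) ℕ.* (2 ℕ.* z) + 4 ℕ.* (a ℕ.* z) ≡ 2 ℕ.* ((3 ℕ.* a + b) ℕ.* z)
    close = solve-∀

  -- A vertex of `S` contributes exactly `b`, and any other vertex at least `a`.
  weights-lower : a ℕ.≤ b → ∀ s (S C P : Subset n) →
    (∀ v → v ∈ S → lookup C v ≡ false × lookup P v ≡ s) →
    b ^ ∣ S ∣ ℕ.* a ^ (n ∸ ∣ S ∣) ℕ.≤ weights s C P
  weights-lower a≤b s [] [] [] _ = ℕ.≤-refl
  weights-lower a≤b s (true ∷ S) (c ∷ C) (x ∷ P) uniform with uniform zero here
  ... | refl , refl = begin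
    b ℕ.* b ^ ∣ S ∣ ℕ.* a ^ (_ ∸ ∣ S ∣)
      ≡⟨ ℕ.*-assoc b (b ^ ∣ S ∣) _ ⟩
    b ℕ.* (b ^ ∣ S ∣ ℕ.* a ^ (_ ∸ ∣ S ∣))
      ≤⟨ ℕ.*-monoʳ-≤ b (weights-lower a≤b s S C P (λ v → uniform (suc v) ∘ there)) ⟩
    b ℕ.* weights s C P
      ≡⟨ cong (λ y → (if y then a else b) ℕ.* weights s C P) (xor-same s) ⟨
    weight s false s ℕ.* weights s C P ∎
    where open ℕ.≤-Reasoning
  weights-lower {suc n} a≤b s (false ∷ S) (c ∷ C) (x ∷ P) uniform = begin
    b ^ ∣ S ∣ ℕ.* a ^ (suc n ∸ ∣ S ∣)
      ≡⟨ cong (λ k → b ^ ∣ S ∣ ℕ.* a ^ k) (ℕ.+-∸-assoc 1 (∣p∣≤n S)) ⟩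
    b ^ ∣ S ∣ ℕ.* (a ℕ.* a ^ (n ∸ ∣ S ∣))
      ≡⟨ eq (b ^ ∣ S ∣) a (a ^ (n ∸ ∣ S ∣)) ⟩
    a ℕ.* (b ^ ∣ S ∣ ℕ.* a ^ (n ∸ ∣ S ∣))
      ≤⟨ ℕ.*-mono-≤ (a≤weight c x) (weights-lower a≤b s S C P (λ v → uniform (suc v) ∘ there)) ⟩
    weight s c x ℕ.* weights s C P ∎
    where
    open ℕ.≤-Reasoning
    eq : ∀ x y z → x ℕ.* (y ℕ.* z) ≡ y ℕ.* (x ℕ.* z)
    eq = solve-∀
    a≤weight : ∀ c x → a ℕ.≤ weight s c x
    a≤weight true  x = ℕ.≤-refl
    a≤weight false x with x xor s
    ... | true  = ℕ.≤-refl
    ... | false = a≤b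

  potential≤total : ∀ s (t : Triangle n) → potential s t ℕ.≤ total t
  potential≤total false t = ℕ.m≤m+n _ _
  potential≤total true  t = ℕ.m≤n+m _ _

-- Inequalities between powers.

-- Passing from `i` to `j` turns `j ∸ i` factors `a` into factors `b`.
^-shift : ∀ {a b i j} → a ℕ.≤ b → i ℕ.≤ j → j ℕ.≤ n →
  b ^ i ℕ.* a ^ (n ∸ i) ℕ.≤ b ^ j ℕ.* a ^ (n ∸ j)
^-shift {n} {a} {b} {i} {j} a≤b i≤j j≤n = begin
  b ^ i ℕ.* a ^ (n ∸ i)
    ≡⟨ cong (λ k → b ^ i ℕ.* a ^ k) split ⟩
  b ^ i ℕ.* a ^ ((j ∸ i) + (n ∸ j))
    ≡⟨ cong (b ^ i ℕ.*_) (ℕ.^-distribˡ-+-* a (j ∸ i) (n ∸ j)) ⟩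
  b ^ i ℕ.* (a ^ (j ∸ i) ℕ.* a ^ (n ∸ j))
    ≤⟨ ℕ.*-monoʳ-≤ (b ^ i) (ℕ.*-monoˡ-≤ _ (ℕ.^-monoˡ-≤ (j ∸ i) a≤b)) ⟩
  b ^ i ℕ.* (b ^ (j ∸ i) ℕ.* a ^ (n ∸ j))
    ≡⟨ ℕ.*-assoc (b ^ i) _ _ ⟨
  b ^ i ℕ.* b ^ (j ∸ i) ℕ.* a ^ (n ∸ j)
    ≡⟨ cong (ℕ._* a ^ (n ∸ j)) (ℕ.^-distribˡ-+-* b i (j ∸ i)) ⟨
  b ^ (i + (j ∸ i)) ℕ.* a ^ (n ∸ j)
    ≡⟨ cong (λ k → b ^ k ℕ.* a ^ (n ∸ j)) (ℕ.m+[n∸m]≡n i≤j) ⟩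
  b ^ j ℕ.* a ^ (n ∸ j) ∎
  where
  open ℕ.≤-Reasoning
  split : n ∸ i ≡ (j ∸ i) + (n ∸ j)
  split = trans (cong (_∸ i) (trans (sym (ℕ.m+[n∸m]≡n j≤n)) (ℕ.+-comm j (n ∸ j))))
    (trans (ℕ.+-∸-assoc (n ∸ j) i≤j) (ℕ.+-comm (n ∸ j) (j ∸ i)))

^-distribʳ-* : ∀ m x y → (x ℕ.* y) ^ m ≡ x ^ m ℕ.* y ^ m
^-distribʳ-* zero    x y = refl
^-distribʳ-* (suc m) x y =
  trans (cong (x ℕ.* y ℕ.*_) (^-distribʳ-* m x y)) (ℕ.[m*n]*[o*p]≡[m*o]*[n*p] x y (x ^ m) (y ^ m))

-- The first factor absorbs the constant 2, and every further factor contributes `P < Q`. This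
-- carries the entropy inequality from one order to all its multiples.
doubled-power-< : ∀ P Q → 2 ℕ.* P ℕ.< Q → ∀ m → 2 ℕ.* P ^ suc m ℕ.< Q ^ suc m
doubled-power-< P Q 2P<Q zero =
  subst₂ (λ x y → 2 ℕ.* x ℕ.< y) (sym (ℕ.*-identityʳ P)) (sym (ℕ.*-identityʳ Q)) 2P<Q
doubled-power-< P Q 2P<Q (suc m) = begin-strict
  2 ℕ.* (P ℕ.* P ^ suc m)   ≡⟨ eq P (P ^ suc m) ⟩
  P ℕ.* (2 ℕ.* P ^ suc m)   ≤⟨ ℕ.*-monoʳ-≤ P (ℕ.<⇒≤ ih) ⟩
  P ℕ.* Q ^ suc m           <⟨ ℕ.*-monoˡ-< (Q ^ suc m) ⦃ Q^>0 ⦄ (ℕ.≤-<-trans (ℕ.m≤n*m P 2) 2P<Q) ⟩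
  Q ℕ.* Q ^ suc m           ∎
  where
  open ℕ.≤-Reasoning
  ih = doubled-power-< P Q 2P<Q m
  Q^>0 : NonZero (Q ^ suc m)
  Q^>0 = ℕ.>-nonZero (ℕ.≤-<-trans z≤n ih)
  eq : ∀ P k → 2 ℕ.* (P ℕ.* k) ≡ P ℕ.* (2 ℕ.* k)
  eq = solve-∀

-- The infinite family and its bound.

module Family (a b k l : ℕ) ⦃ _ : NonZero (k + l) ⦄ (a≤b : a ℕ.≤ b)
  (entropy : 2 ℕ.* (3 ℕ.* a + b) ^ (k + l) ℕ.< 2 ^ (k + l) ℕ.* (b ^ k ℕ.* a ^ l)) where

  open FirstMoment a b

  -- Multiples of `k + l` make the fraction k / (k + l) of the order an integer, and `suc i` keeps
  -- the graph nonempty.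
  size : ℕ → ℕ
  size i = (k + l) ℕ.* suc i

  size≢0 : ∀ i → NonZero (size i)
  size≢0 i = ℕ.m*n≢0 (k + l) (suc i)

  triangle : ∀ i → Triangle (size i)
  triangle i = proj₁ (∃-small-total (size i))

  member : ℕ → Graph
  member i = graph ⦃ size≢0 i ⦄ (triangle i)

  -- Otherwise the weight of `C` alone would exceed the bound on `total` from `∃-small-total`.
  uniform-bound : ∀ i s S C → Nonempty C → Uniform (member i) s C S → ∣ S ∣ ℕ.≤ k ℕ.* suc i
  uniform-bound i s S C C≢∅ uniform = ℕ.≮⇒≥ λ large → ℕ.<-irrefl refl (begin-strict
    2 ℕ.* (3 ℕ.* a + b) ^ nᵢ
      ≡⟨ cong (2 ℕ.*_) (ℕ.^-*-assoc (3 ℕ.* a + b) (k + l) (suc i)) ⟨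
    2 ℕ.* ((3 ℕ.* a + b) ^ (k + l)) ^ suc i
      -- The factor 2, which comes from the two parities, is absorbed here.
      <⟨ doubled-power-< ((3 ℕ.* a + b) ^ (k + l)) _ entropy i ⟩
    (2 ^ (k + l) ℕ.* (b ^ k ℕ.* a ^ l)) ^ suc i
      ≡⟨ expand ⟩
    2 ^ nᵢ ℕ.* (b ^ (k ℕ.* suc i) ℕ.* a ^ (nᵢ ∸ k ℕ.* suc i))
      ≤⟨ ℕ.*-monoʳ-≤ (2 ^ nᵢ) (^-shift a≤b (ℕ.<⇒≤ large) (∣p∣≤n S)) ⟩
    2 ^ nᵢ ℕ.* (b ^ ∣ S ∣ ℕ.* a ^ (nᵢ ∸ ∣ S ∣))
      ≤⟨ ℕ.*-monoʳ-≤ (2 ^ nᵢ) (weights-lower a≤b s S C _ uniform′) ⟩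
    2 ^ nᵢ ℕ.* weights s C (parities tᵢ C)
      ≤⟨ ℕ.*-monoʳ-≤ (2 ^ nᵢ) (term≤∑⁺ (λ C → weights s C (parities tᵢ C)) C C≢∅) ⟩
    2 ^ nᵢ ℕ.* potential s tᵢ
      ≤⟨ ℕ.*-monoʳ-≤ (2 ^ nᵢ) (potential≤total s tᵢ) ⟩
    2 ^ nᵢ ℕ.* total tᵢ
      ≤⟨ proj₂ (∃-small-total nᵢ) ⟩
    2 ℕ.* (3 ℕ.* a + b) ^ nᵢ ∎)
    where
    open ℕ.≤-Reasoning
    nᵢ = size i
    tᵢ = triangle i
    uniform′ : ∀ v → v ∈ S → lookup C v ≡ false × lookup (parities tᵢ C) v ≡ s
    uniform′ v v∈S with uniform v v∈S
    ... | Cv , Ov = Cv , trans (sym (lookup-Odd-graph ⦃ size≢0 i ⦄ tᵢ C v)) Ov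
    remainder : l ℕ.* suc i ≡ nᵢ ∸ k ℕ.* suc i
    remainder = sym (trans (cong (_∸ k ℕ.* suc i) (ℕ.*-distribʳ-+ (suc i) k l))
      (ℕ.m+n∸m≡n (k ℕ.* suc i) _))
    expand : (2 ^ (k + l) ℕ.* (b ^ k ℕ.* a ^ l)) ^ suc i
      ≡ 2 ^ nᵢ ℕ.* (b ^ (k ℕ.* suc i) ℕ.* a ^ (nᵢ ∸ k ℕ.* suc i))
    expand = trans (^-distribʳ-* (suc i) (2 ^ (k + l)) _)
      (cong₂ ℕ._*_ (ℕ.^-*-assoc 2 (k + l) (suc i))
        (trans (^-distribʳ-* (suc i) (b ^ k) _)
          (cong₂ ℕ._*_ (ℕ.^-*-assoc b k (suc i))
            (trans (ℕ.^-*-assoc a l (suc i)) (cong (a ^_) remainder)))))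

  κQ-member : ∀ i → κQ (member i) ℕ.≤ k ℕ.* suc i
  κQ-member i = κQ-upper (member i) (k ℕ.* suc i) (uniform-bound i)

  -- Isomorphic graphs have equal order, and the order determines the index.
  member-≇ : ∀ i j → i ≢ j → ¬ (member i ≅ member j)
  member-≇ i j i≢j iso =
    i≢j (ℕ.suc-injective (ℕ.*-cancelˡ-≡ (suc i) (suc j) (k + l) (↔⇒≡ (_≅_.bijection iso))))

-- Passage to the rationals and choice of the constants.

-- For unnormalised rationals the inequality is a cross-multiplication, free of reduction to lowest
-- terms.
≤-fraction : ∀ q k d n → q ℕ.* suc d ℕ.≤ k ℕ.* n →
  (+ q) / 1 ≤ ((+ k) / suc d) * ((+ n) / 1)
≤-fraction q k d n h = ℚ.toℚᵘ-cancel-≤ (begin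
  ℚ.toℚᵘ ((+ q) / 1)
    ≃⟨ ℚ.toℚᵘ-fromℚᵘ (mkℚᵘ (+ q) 0) ⟩
  mkℚᵘ (+ q) 0
    ≤⟨ *≤* numerators ⟩
  mkℚᵘ (+ k) d ℚᵘ.* mkℚᵘ (+ n) 0
    ≃⟨ ℚᵘ.*-cong (ℚ.toℚᵘ-fromℚᵘ (mkℚᵘ (+ k) d)) (ℚ.toℚᵘ-fromℚᵘ (mkℚᵘ (+ n) 0)) ⟨
  ℚ.toℚᵘ ((+ k) / suc d) ℚᵘ.* ℚ.toℚᵘ ((+ n) / 1)
    ≃⟨ ℚ.toℚᵘ-homo-* ((+ k) / suc d) ((+ n) / 1) ⟨
  ℚ.toℚᵘ (((+ k) / suc d) * ((+ n) / 1)) ∎)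
  where
  open ℚᵘ.≤-Reasoning
  numerators : + q ℤ.* + (suc d ℕ.* 1) ℤ.≤ (+ k ℤ.* + n) ℤ.* + 1
  numerators = subst₂ ℤ._≤_ (ℤ.pos-* q (suc d ℕ.* 1)) (trans (ℤ.pos-* k n) (sym (ℤ.*-identityʳ _)))
    (ℤ.+≤+ (subst (λ e → q ℕ.* e ℕ.≤ k ℕ.* n) (sym (ℕ.*-identityʳ (suc d))) h))

-- With p = 0.189 the optimal ratio of the two weights is a / b = p / (3 (1 − p)) = 63 / 811;
-- the right-hand side is about 2 ^ 1.067 times 1000 ^ 1000.
entropy-0·189 : 2 ℕ.* (3 ℕ.* 63 + 811) ^ (811 + 189) ℕ.< 2 ^ (811 + 189) ℕ.* (811 ^ 811 ℕ.* 63 ^ 189)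
entropy-0·189 = ℕ.<ᵇ⇒< _ _ _

open Family 63 811 811 189 (ℕ.≤ᵇ⇒≤ 63 811 _) entropy-0·189

theorem8 : ∃ λ (G : ℕ → Graph) →
    (∀ i j → i ≢ j → ¬ (G i ≅ G j)) ×
    (∀ i → (+ κQ (G i)) / 1 ≤ ((+ 811) / 1000) * ((+ order (G i)) / 1))
-- The argument `999` encodes the denominator 1000 by its predecessor.
theorem8 = member , member-≇ , λ i → ≤-fraction (κQ (member i)) 811 999 (size i) (bound i)
  where
  swap : ∀ x y z → x ℕ.* (y ℕ.* z) ≡ (x ℕ.* z) ℕ.* y
  swap = solve-∀
  bound : ∀ i → κQ (member i) ℕ.* 1000 ℕ.≤ 811 ℕ.* size i
  bound i = ℕ.≤-trans (ℕ.*-monoˡ-≤ 1000 (κQ-member i)) (ℕ.≤-reflexive (sym (swap 811 1000 (suc i))))
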